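{- Let $G$ be a simple graph of order $n$. Then the strong alliance polynomial $a(G;x)$ and the defensive alliance polynomial $da(G;x,y)$ satisfy $$a(G;x) = \sum_{k=0}^{n-1}[y^{n+k}]\,da(G;x,y).$$
   Context: All graphs are finite, simple and have at least one vertex. For a graph $G$, $S\subseteq V(G)$ and $u\in V(G)$, let $\bar S=V(G)\setminus S$, let $\delta_S(u)=|\{v\in S:\{u,v\}\in E(G)\}|$, and let $G[S]$ be the subgraph induced by $S$. The defensive alliance polynomial of $G$ is $$da(G;x,y)=\sum_{S} x^{|S|}\,y^{f_y(S)},\qquad f_y(S)=\min_{u\in S}\bigl(\delta_S(u)-\delta_{\bar S}(u)+|V(G)|\bigr),$$ where the sum runs over all non-empty $S\subseteq V(G)$ such that $G[S]$ is connected (single-vertex graphs are connected). $[y^l]\,da(G;x,y)$ denotes the coefficient of $y^l$ in $da(G;x,y)$, which is a polynomial in $x$. A non-empty set $S\subseteq V(G)$ is a strong defensive alliance if $\delta_S(v)-\delta_{\bar S}(v)\ge 0$ for all $v\in S$. The strong alliance polynomial is $a(G;x)=\sum_S x^{|S|}$, where the sum runs over all non-empty $S\subseteq V(G)$ such that $G[S]$ is connected and $S$ is a strong defensive alliance. -}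

module Defs where

open import Algebra.Bundles.Raw using (RawMonoid)
open import Data.Fin.Base using (Fin)
open import Data.Fin.Properties using () renaming (_≟_ to _≟ᶠ_)
open import Data.Fin.Subset
  using (Subset; inside; outside; _∈_; ∁; ∣_∣; Nonempty; Lift)
open import Data.Fin.Subset.Properties using (_∈?_; nonempty?; Lift?)
open import Data.Integer.Base as ℤ using (ℤ; 0ℤ; 1ℤ; +_)
import Data.Integer.Properties as ℤ
open import Data.List.Base as List
  using (List; []; _∷_; _++_; foldr; map; filter; length; allFin; replicate)
open import Data.List.Extrema ℤ.≤-totalOrder using (min; v≤min⁺)
import Data.List.Membership.Propositional as List
open import Data.List.Membership.Propositional.Properties using (∈-map⁺)
open import Data.List.Properties using (length-filter; length-tabulate)
open import Data.List.Relation.Unary.All as All using (All)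
import Data.List.Relation.Unary.All.Properties as All
open import Data.List.Relation.Unary.Any using (here; there)
open import Data.Nat.Base as ℕ using (ℕ; zero; suc)
import Data.Nat.Properties as ℕ
open import Data.Product.Base using (∃; _×_; _,_; proj₁)
open import Data.Sum.Base using (_⊎_; inj₁; inj₂)
open import Data.Vec.Base as Vec using (Vec)
open import Data.Vec.Properties.WithK using ([]=-irrelevant)
open import Function.Base using (_∘_; id)
open import Level using (0ℓ)
open import Relation.Binary.Construct.Closure.ReflexiveTransitive
  using (Star; ε; _◅_; _◅◅_)
open import Relation.Binary.Core using (Rel)
open import Relation.Binary.Definitions
  using (Decidable; Symmetric; Irreflexive; DecidableEquality)
open import Relation.Binary.PropositionalEquality
  using (_≡_; refl; sym; cong; subst)
open import Relation.Nullary.Decidable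
  using (Dec; yes; no; map′; _×-dec_; _⊎-dec_)

-- A polynomial is its list of coefficients, constant term first.  Trailing
-- zeros are allowed, so polynomials are compared by _≈_ below and not by _≡_.
-- Only the additive structure of the coefficients is involved.

sumOver : ∀ {c ℓ} (M : RawMonoid c ℓ) {A : Set} →
          List A → (A → RawMonoid.Carrier M) → RawMonoid.Carrier M
sumOver M xs f = foldr (λ x s → f x ∙ s) (RawMonoid.ε M) xs
  where open RawMonoid M using (_∙_)

module Polynomial {c ℓ} (M : RawMonoid c ℓ) where
  open RawMonoid M renaming (Carrier to R; _≈_ to _≈ᴿ_; _∙_ to _+ᴿ_; ε to 0#)

  Poly : Set c
  Poly = List R

  coeff : Poly → ℕ → R
  coeff []      _       = 0#
  coeff (a ∷ p) zero    = a
  coeff (a ∷ p) (suc i) = coeff p i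

  infix 4 _≈_
  _≈_ : Rel Poly ℓ
  p ≈ q = ∀ i → coeff p i ≈ᴿ coeff q i

  infixl 6 _+_
  _+_ : Poly → Poly → Poly
  []      + q       = q
  (a ∷ p) + []      = a ∷ p
  (a ∷ p) + (b ∷ q) = (a +ᴿ b) ∷ (p + q)

  -- monomial k a = a · (variable)ᵏ
  monomial : ℕ → R → Poly
  monomial k a = replicate k 0# ++ (a ∷ [])

  rawMonoid : RawMonoid c ℓ
  rawMonoid = record { Carrier = Poly ; _≈_ = _≈_ ; _∙_ = _+_ ; ε = [] }

-- Bivariate polynomials are treated as ℤ[x][y].

module ℤ[x] = Polynomial ℤ.+-0-rawMonoid
module ℤ[x][y] = Polynomial ℤ[x].rawMonoid

infix 4 _≈_
_≈_ : Rel ℤ[x].Poly 0ℓ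
_≈_ = ℤ[x]._≈_

x^_ : ℕ → ℤ[x].Poly
x^ k = ℤ[x].monomial k 1ℤ

x^_y^_ : ℕ → ℕ → ℤ[x][y].Poly
x^ i y^ j = ℤ[x][y].monomial j (x^ i)

[y^_]_ : ℕ → ℤ[x][y].Poly → ℤ[x].Poly
[y^ l ] p = ℤ[x][y].coeff p l

record Graph (V : Set) : Set₁ where
  field
    Adj        : Rel V 0ℓ
    adj?       : Decidable Adj
    adj-sym    : Symmetric Adj
    adj-irrefl : Irreflexive _≡_ Adj

open Graph public

Connected : ∀ {V} → Graph V → Set
Connected G = ∀ u v → Star (Adj G) u v

infix 10 _[_]
_[_] : ∀ {n} → Graph (Fin n) → (S : Subset n) → Graph (∃ (_∈ S))
G [ S ] = record
  { Adj        = λ u v → Adj G (proj₁ u) (proj₁ v)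
  ; adj?       = λ u v → adj? G (proj₁ u) (proj₁ v)
  ; adj-sym    = adj-sym G
  ; adj-irrefl = adj-irrefl G ∘ cong proj₁
  }

-- Warshall's algorithm: the vertices of a complete list vs are allowed one by
-- one as intermediate vertices of a walk.
module _ {V : Set} (_≟_ : DecidableEquality V)
         (vs : List V) (complete : ∀ v → v List.∈ vs) (G : Graph V) where

  private
    Via : List V → Rel V 0ℓ
    Via []       u v = u ≡ v ⊎ Adj G u v
    Via (w ∷ ws) u v = Via ws u v ⊎ (Via ws u w × Via ws w v)

    via? : ∀ ws → Decidable (Via ws)
    via? []       u v = (u ≟ v) ⊎-dec adj? G u v
    via? (w ∷ ws) u v = via? ws u v ⊎-dec (via? ws u w ×-dec via? ws w v)

    via⇒star : ∀ ws {u v} → Via ws u v → Star (Adj G) u v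
    via⇒star []       (inj₁ refl)    = ε
    via⇒star []       (inj₂ e)       = e ◅ ε
    via⇒star (w ∷ ws) (inj₁ p)       = via⇒star ws p
    via⇒star (w ∷ ws) (inj₂ (p , q)) = via⇒star ws p ◅◅ via⇒star ws q

    base : ∀ ws {u v} → Via [] u v → Via ws u v
    base []       p = p
    base (w ∷ ws) p = inj₁ (base ws p)

    through : ∀ ws {u w v} → w List.∈ ws → Via ws u w → Via ws w v → Via ws u v
    through (w ∷ ws) (here refl) p q = inj₂ (to p , from q)
      where
      to : ∀ {u} → Via (w ∷ ws) u w → Via ws u w
      to (inj₁ r)       = r
      to (inj₂ (r , _)) = r
      from : ∀ {v} → Via (w ∷ ws) w v → Via ws w v
      from (inj₁ r)       = r
      from (inj₂ (_ , r)) = r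
    through (w ∷ ws) (there i) (inj₁ p) (inj₁ q) = inj₁ (through ws i p q)
    through (w ∷ ws) (there i) (inj₁ p) (inj₂ (q , r)) = inj₂ (through ws i p q , r)
    through (w ∷ ws) (there i) (inj₂ (p , q)) (inj₁ r) = inj₂ (p , through ws i q r)
    through (w ∷ ws) (there i) (inj₂ (p , _)) (inj₂ (_ , r)) = inj₂ (p , r)

    star⇒via : ∀ {u v} → Star (Adj G) u v → Via vs u v
    star⇒via ε       = base vs (inj₁ refl)
    star⇒via (e ◅ p) = through vs (complete _) (base vs (inj₂ e)) (star⇒via p)

  connected-by-listing? : Dec (Connected G)
  connected-by-listing? = map′
    (λ h u v → via⇒star vs (All.lookup (All.lookup h (complete u)) (complete v)))
    (λ c → All.universal (λ u → All.universal (λ v → star⇒via (c u v)) vs) vs)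
    (All.all? (λ u → All.all? (via? vs u) vs) vs)

private
  members : ∀ {n} (S : Subset n) → List (∃ (_∈ S))
  members Vec.[]            = []
  members (outside Vec.∷ S) = map (λ (v , i) → Fin.suc v , Vec.there i) (members S)
  members (inside Vec.∷ S)  = (Fin.zero , Vec.here)
    ∷ map (λ (v , i) → Fin.suc v , Vec.there i) (members S)

  members-complete : ∀ {n} (S : Subset n) v → v List.∈ members S
  members-complete (inside Vec.∷ S)  (_ , Vec.here)    = here refl
  members-complete (inside Vec.∷ S)  (_ , Vec.there i) =
    there (∈-map⁺ _ (members-complete S (_ , i)))
  members-complete (outside Vec.∷ S) (_ , Vec.there i) =
    ∈-map⁺ _ (members-complete S (_ , i))

  _≟ᵐ_ : ∀ {n} {S : Subset n} → DecidableEquality (∃ (_∈ S))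
  (u , i) ≟ᵐ (v , j) = map′ (pair i j) (cong proj₁) (u ≟ᶠ v)
    where
    pair : ∀ {n} {S : Subset n} {u v} (i : u ∈ S) (j : v ∈ S) →
           u ≡ v → _≡_ {A = ∃ (_∈ S)} (u , i) (v , j)
    pair i j refl = cong (_ ,_) ([]=-irrelevant i j)

connected? : ∀ {n} (G : Graph (Fin n)) S → Dec (Connected (G [ S ]))
connected? G S =
  connected-by-listing? _≟ᵐ_ (members S) (members-complete S) (G [ S ])

subsets : ∀ n → List (Subset n)
subsets zero    = Vec.[] ∷ []
subsets (suc n) = map (outside Vec.∷_) (subsets n) ++ map (inside Vec.∷_) (subsets n)

module _ {n : ℕ} (G : Graph (Fin n)) where

  δ : Subset n → Fin n → ℕ
  δ S u = length (filter (λ v → (v ∈? S) ×-dec adj? G u v) (allFin n))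

  excess : Subset n → Fin n → ℤ
  excess S u = + δ S u ℤ.- + δ (∁ S) u

  -- The default value that `min` requires is taken at the given element of S.
  fy : (S : Subset n) → Nonempty S → ℤ
  fy S (u₀ , _) = min (g u₀) (map g (filter (_∈? S) (allFin n)))
    where
    g : Fin n → ℤ
    g u = excess S u ℤ.+ + n

  StrongDefensiveAlliance : Subset n → Set
  StrongDefensiveAlliance S =
    Nonempty S × Lift (λ v → 0ℤ ℤ.≤ excess S v) S

  strongDefensiveAlliance? : ∀ S → Dec (StrongDefensiveAlliance S)
  strongDefensiveAlliance? S =
    nonempty? S ×-dec Lift? (λ v → 0ℤ ℤ.≤? excess S v) S

  -- fy is never negative (see 0≤fy below), so ∣_∣ only changes its type.
  daTerm : ∀ S → Dec (Nonempty S × Connected (G [ S ])) → ℤ[x][y].Poly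
  daTerm S (yes (S≢∅ , _)) = x^ ∣ S ∣ y^ ℤ.∣ fy S S≢∅ ∣
  daTerm S (no _)          = []

  da : ℤ[x][y].Poly
  da = sumOver ℤ[x][y].rawMonoid (subsets n)
         (λ S → daTerm S (nonempty? S ×-dec connected? G S))

  a : ℤ[x].Poly
  a = sumOver ℤ[x].rawMonoid
        (filter (λ S → nonempty? S ×-dec connected? G S ×-dec strongDefensiveAlliance? S)
                (subsets n))
        (λ S → x^ ∣ S ∣)

  δ≤n : ∀ S u → δ S u ℕ.≤ n
  δ≤n S u = subst (δ S u ℕ.≤_) (length-tabulate {n = n} id) (length-filter _ (allFin n))

  0≤excess+n : ∀ S u → 0ℤ ℤ.≤ excess S u ℤ.+ + n
  0≤excess+n S u = begin
    0ℤ                                          ≤⟨ ℤ.i≤j⇒0≤j-i (ℤ.+≤+ (δ≤n (∁ S) u)) ⟩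
    + n ℤ.- + δ (∁ S) u                         ≡⟨ ℤ.+-comm (+ n) (ℤ.- (+ δ (∁ S) u)) ⟩
    ℤ.- (+ δ (∁ S) u) ℤ.+ + n                   ≤⟨ ℤ.i≤j+i _ (+ δ S u) ⟩
    + δ S u ℤ.+ (ℤ.- (+ δ (∁ S) u) ℤ.+ + n)     ≡⟨ ℤ.+-assoc (+ δ S u) (ℤ.- (+ δ (∁ S) u)) (+ n) ⟨
    excess S u ℤ.+ + n                          ∎
    where open ℤ.≤-Reasoning

  0≤fy : ∀ S (S≢∅ : Nonempty S) → 0ℤ ℤ.≤ fy S S≢∅
  0≤fy S (u₀ , _) =
    v≤min⁺ (0≤excess+n S u₀) (All.map⁺ (All.universal (0≤excess+n S) (filter (_∈? S) (allFin n))))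

-- Only the coefficients [yˡ] da with n ≤ l < 2n are collected.  Since u is not
-- its own neighbour, δ_S(u) < n, so every f_y(S) is below 2n; and n ≤ f_y(S)
-- says exactly that S is a strong defensive alliance.  Hence, summed over k,
-- the monomial of S contributes x^|S| if S is a strong alliance and 0 if not.

module Submission where

open import Defs
open import Algebra.Bundles.Raw using (RawMonoid)
open import Algebra.Consequences.Propositional using (comm∧assoc⇒middleFour)
open import Algebra.Definitions using (LeftIdentity; RightIdentity)
open import Algebra.Structures using (IsCommutativeMonoid)
open import Data.Fin.Base using (Fin)
open import Data.Fin.Subset using (Subset; Nonempty; ∁; ∣_∣)
open import Data.Fin.Subset.Properties using (_∈?_; nonempty?)
open import Data.Integer.Base as ℤ using (0ℤ; +_; +≤+; +<+)
import Data.Integer.Properties as ℤ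
open import Data.List.Base using (List; []; _∷_; allFin; filter; map; upTo)
open import Data.List.Extrema ℤ.≤-totalOrder using (v≤min⁺; min≤⊤; min≤xs)
import Data.List.Membership.Propositional as List
open import Data.List.Membership.Propositional.Properties
  using (∈-allFin; ∈-filter⁺; ∈-upTo⁺)
open import Data.List.Properties using (filter-notAll; length-tabulate)
open import Data.List.Relation.Unary.All as All using (All)
import Data.List.Relation.Unary.All.Properties as All
open import Data.List.Relation.Unary.AllPairs using (_∷_)
import Data.List.Relation.Unary.Any as Any
open import Data.List.Relation.Unary.Any using (here; there)
open import Data.List.Relation.Unary.Unique.Propositional using (Unique)
open import Data.List.Relation.Unary.Unique.Propositional.Properties using (upTo⁺)
open import Data.Nat.Base as ℕ using (ℕ; zero; suc; NonZero; _+_; _∸_)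
import Data.Nat.Properties as ℕ
open import Data.Product.Base using (_×_; _,_)
open import Function.Base using (_∘_; id)
open import Relation.Binary.PropositionalEquality
  using (_≡_; _≢_; refl; sym; trans; cong; cong₂; subst; isEquivalence; module ≡-Reasoning)
open import Relation.Nullary.Decidable using (Dec; yes; no; _×-dec_)
open import Relation.Nullary.Negation using (¬_; contradiction)
open import Relation.Unary using (Pred; Decidable)

-- Finite sums in a commutative monoid.

sumOver-homo : ∀ {c₁ ℓ₁ c₂ ℓ₂} (M : RawMonoid c₁ ℓ₁) (N : RawMonoid c₂ ℓ₂) →
  let module M = RawMonoid M ; module N = RawMonoid N in
  (h : M.Carrier → N.Carrier) →
  h M.ε ≡ N.ε → (∀ p q → h (p M.∙ q) ≡ h p N.∙ h q) →
  ∀ {A : Set} (xs : List A) f → h (sumOver M xs f) ≡ sumOver N xs (h ∘ f)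
sumOver-homo M N h h-ε h-∙ []       f = h-ε
sumOver-homo M N h h-ε h-∙ (x ∷ xs) f = trans (h-∙ _ _)
  (cong (RawMonoid._∙_ N (h (f x))) (sumOver-homo M N h h-ε h-∙ xs f))

module _ {c ℓ} (M : RawMonoid c ℓ)
         (isCM : IsCommutativeMonoid _≡_ (RawMonoid._∙_ M) (RawMonoid.ε M)) where
  open RawMonoid M using (Carrier; _∙_; ε)
  open IsCommutativeMonoid isCM using (identityˡ; identityʳ; assoc; comm)

  sumOver-cong : ∀ {A : Set} (xs : List A) {f g : A → Carrier} →
                 (∀ x → f x ≡ g x) → sumOver M xs f ≡ sumOver M xs g
  sumOver-cong []       f≗g = refl
  sumOver-cong (x ∷ xs) f≗g = cong₂ _∙_ (f≗g x) (sumOver-cong xs f≗g)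

  sumOver-zero : ∀ {A : Set} {xs : List A} {f : A → Carrier} →
                 All (λ x → f x ≡ ε) xs → sumOver M xs f ≡ ε
  sumOver-zero All.[]          = refl
  sumOver-zero (fx≡ε All.∷ ps) = trans (cong₂ _∙_ fx≡ε (sumOver-zero ps)) (identityˡ ε)

  -- Uniqueness guarantees that `j` occurs once, so every entry before or after that occurrence
  -- differs from `j` and contributes `ε`.
  sumOver-single : ∀ {A : Set} {xs : List A} {f : A → Carrier} {j} → Unique xs → j List.∈ xs →
                   (∀ k → j ≢ k → f k ≡ ε) → sumOver M xs f ≡ f j
  sumOver-single (j∉xs ∷ _) (here refl) off =
    trans (cong (_ ∙_) (sumOver-zero (All.map (off _) j∉xs))) (identityʳ _)
  sumOver-single (x∉xs ∷ xs!) (there j∈xs) off = trans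
    (cong₂ _∙_ (off _ (λ j≡x → All.lookup x∉xs j∈xs (sym j≡x))) (sumOver-single xs! j∈xs off))
    (identityˡ _)

  sumOver-∙ : ∀ {A : Set} (xs : List A) (f g : A → Carrier) →
              sumOver M xs (λ x → f x ∙ g x) ≡ sumOver M xs f ∙ sumOver M xs g
  sumOver-∙ []       f g = sym (identityˡ ε)
  sumOver-∙ (x ∷ xs) f g =
    trans (cong (f x ∙ g x ∙_) (sumOver-∙ xs f g))
          (comm∧assoc⇒middleFour comm assoc (f x) (g x) _ _)

  sumOver-swap : ∀ {A B : Set} (xs : List A) (ys : List B) (f : A → B → Carrier) →
                 sumOver M xs (λ x → sumOver M ys (f x)) ≡
                 sumOver M ys (λ y → sumOver M xs (λ x → f x y))
  sumOver-swap []       ys f = sym (sumOver-zero (All.universal (λ _ → refl) ys))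
  sumOver-swap (x ∷ xs) ys f =
    trans (cong (sumOver M ys (f x) ∙_) (sumOver-swap xs ys f)) (sym (sumOver-∙ ys (f x) _))

  -- With two summands, the filter is dropped and the summand replaced in one pass: `f` matters only
  -- where `P` holds, and `g` vanishes elsewhere.
  sumOver-filter : ∀ {p} {A : Set} {P : Pred A p} (P? : Decidable P) {f g : A → Carrier} →
                   (∀ {x} → P x → f x ≡ g x) → (∀ {x} → ¬ P x → g x ≡ ε) →
                   ∀ xs → sumOver M (filter P? xs) f ≡ sumOver M xs g
  sumOver-filter P? f≡g g≡ε [] = refl
  sumOver-filter P? {g = g} f≡g g≡ε (x ∷ xs) with P? x
  ... | yes px = cong₂ _∙_ (f≡g px) (sumOver-filter P? f≡g g≡ε xs)
  ... | no ¬px = trans (sumOver-filter P? f≡g g≡ε xs)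
                       (sym (trans (cong (_∙ sumOver M xs g) (g≡ε ¬px)) (identityˡ _)))

-- Coefficients and addition of polynomials.

module _ {c ℓ} (M : RawMonoid c ℓ) where
  open RawMonoid M using (_∙_; ε)
  open Polynomial M using (Poly; coeff; monomial) renaming (_+_ to _+ᴾ_)

  -- The identity laws serve the cases where one list has run out and its coefficient is read as
  -- `ε`.
  coeff-+ : LeftIdentity _≡_ ε _∙_ → RightIdentity _≡_ ε _∙_ →
            ∀ i (p q : Poly) → coeff (p +ᴾ q) i ≡ coeff p i ∙ coeff q i
  coeff-+ idˡ idʳ i       []      q       = sym (idˡ _)
  coeff-+ idˡ idʳ i       (a ∷ p) []      = sym (idʳ _)
  coeff-+ idˡ idʳ zero    (a ∷ p) (b ∷ q) = refl
  coeff-+ idˡ idʳ (suc i) (a ∷ p) (b ∷ q) = coeff-+ idˡ idʳ i p q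

  coeff-monomial-≡ : ∀ k a → coeff (monomial k a) k ≡ a
  coeff-monomial-≡ zero    a = refl
  coeff-monomial-≡ (suc k) a = coeff-monomial-≡ k a

  coeff-monomial-≢ : ∀ k l a → k ≢ l → coeff (monomial k a) l ≡ ε
  coeff-monomial-≢ zero    zero    a k≢l = contradiction refl k≢l
  coeff-monomial-≢ zero    (suc l) a k≢l = refl
  coeff-monomial-≢ (suc k) zero    a k≢l = refl
  coeff-monomial-≢ (suc k) (suc l) a k≢l = coeff-monomial-≢ k l a (k≢l ∘ cong suc)

  module _ (isCM : IsCommutativeMonoid _≡_ _∙_ ε) where
    open IsCommutativeMonoid isCM using (assoc; comm)

    +ᴾ-identityʳ : ∀ p → p +ᴾ [] ≡ p
    +ᴾ-identityʳ []      = refl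
    +ᴾ-identityʳ (a ∷ p) = refl

    +ᴾ-assoc : ∀ p q r → (p +ᴾ q) +ᴾ r ≡ p +ᴾ (q +ᴾ r)
    +ᴾ-assoc []      q       r       = refl
    +ᴾ-assoc (a ∷ p) []      r       = refl
    +ᴾ-assoc (a ∷ p) (b ∷ q) []      = refl
    +ᴾ-assoc (a ∷ p) (b ∷ q) (d ∷ r) = cong₂ _∷_ (assoc a b d) (+ᴾ-assoc p q r)

    +ᴾ-comm : ∀ p q → p +ᴾ q ≡ q +ᴾ p
    +ᴾ-comm []      q       = sym (+ᴾ-identityʳ q)
    +ᴾ-comm (a ∷ p) []      = refl
    +ᴾ-comm (a ∷ p) (b ∷ q) = cong₂ _∷_ (comm a b) (+ᴾ-comm p q)

    -- The laws hold up to `≡` despite possible trailing zeros, because a sum is exactly as long as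
    -- its longer summand. Hence the construction can be iterated, and all later sums are compared
    -- by `≡`.
    +ᴾ-isCommutativeMonoid : IsCommutativeMonoid _≡_ _+ᴾ_ []
    +ᴾ-isCommutativeMonoid = record
      { isMonoid = record
        { isSemigroup = record
          { isMagma = record { isEquivalence = isEquivalence ; ∙-cong = cong₂ _+ᴾ_ }
          ; assoc   = +ᴾ-assoc
          }
        ; identity = (λ _ → refl) , +ᴾ-identityʳ
        }
      ; comm = +ᴾ-comm
      }

ℤ[x]-isCommutativeMonoid : IsCommutativeMonoid _≡_ ℤ[x]._+_ []
ℤ[x]-isCommutativeMonoid =
  +ᴾ-isCommutativeMonoid ℤ.+-0-rawMonoid ℤ.+-0-isCommutativeMonoid

[y^]-sumOver : ∀ l {A : Set} (xs : List A) f →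
  [y^ l ] (sumOver ℤ[x][y].rawMonoid xs f) ≡ sumOver ℤ[x].rawMonoid xs (λ x → [y^ l ] f x)
[y^]-sumOver l = sumOver-homo ℤ[x][y].rawMonoid ℤ[x].rawMonoid [y^ l ]_ refl
  (coeff-+ ℤ[x].rawMonoid identityˡ identityʳ l)
  where open IsCommutativeMonoid ℤ[x]-isCommutativeMonoid using (identityˡ; identityʳ)

-- Collecting the coefficients of a range of powers of y.

module _ (n : ℕ) where

  -- The right-hand side of the theorem for an arbitrary polynomial, so that it can be evaluated on
  -- the term of one subset at a time.
  window : ℤ[x][y].Poly → ℤ[x].Poly
  window p = sumOver ℤ[x].rawMonoid (upTo n) (λ k → [y^ (n + k) ] p)

  window-zero : window [] ≡ []
  window-zero = sumOver-zero ℤ[x].rawMonoid ℤ[x]-isCommutativeMonoid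
    (All.universal (λ _ → refl) (upTo n))

  -- Only `k = l ∸ n` satisfies `n + k ≡ l`. The lower bound makes the truncated subtraction exact;
  -- the upper bound puts this `k` into `upTo n`.
  window-inside : ∀ i {l} → n ℕ.≤ l → l ℕ.< n + n → window (x^ i y^ l) ≡ x^ i
  window-inside i {l} n≤l l<2n = begin
    window (x^ i y^ l)             ≡⟨ sumOver-single ℤ[x].rawMonoid ℤ[x]-isCommutativeMonoid
                                        (upTo⁺ n) (∈-upTo⁺ l∸n<n) off ⟩
    [y^ n + (l ∸ n) ] (x^ i y^ l)  ≡⟨ cong ([y^_] (x^ i y^ l)) n+[l∸n]≡l ⟩
    [y^ l ] (x^ i y^ l)            ≡⟨ coeff-monomial-≡ ℤ[x].rawMonoid l (x^ i) ⟩
    x^ i                           ∎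
    where
    open ≡-Reasoning
    n+[l∸n]≡l : n + (l ∸ n) ≡ l
    n+[l∸n]≡l = ℕ.m+[n∸m]≡n n≤l
    l∸n<n : l ∸ n ℕ.< n
    l∸n<n = ℕ.+-cancelˡ-< n _ _ (subst (ℕ._< n + n) (sym n+[l∸n]≡l) l<2n)
    off : ∀ k → l ∸ n ≢ k → [y^ (n + k) ] (x^ i y^ l) ≡ []
    off k l∸n≢k = coeff-monomial-≢ ℤ[x].rawMonoid l (n + k) (x^ i)
      (λ l≡n+k → l∸n≢k (ℕ.+-cancelˡ-≡ n _ _ (trans n+[l∸n]≡l l≡n+k)))

  window-below : ∀ i {l} → l ℕ.< n → window (x^ i y^ l) ≡ []
  window-below i {l} l<n = sumOver-zero ℤ[x].rawMonoid ℤ[x]-isCommutativeMonoid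
    (All.universal (λ k → coeff-monomial-≢ ℤ[x].rawMonoid l (n + k) (x^ i)
      (ℕ.<⇒≢ (ℕ.<-≤-trans l<n (ℕ.m≤m+n n k)))) (upTo n))

-- Exponents of y and strong alliances.

module _ {n : ℕ} (G : Graph (Fin n)) where

  δ<n : ∀ S u → δ G S u ℕ.< n
  δ<n S u = subst (δ G S u ℕ.<_) (length-tabulate {n = n} id)
    (filter-notAll (λ v → (v ∈? S) ×-dec adj? G u v) (allFin n)
      -- The vertex that the filter is certain to drop is `u` itself.
      (Any.map (λ { refl (_ , u~u) → adj-irrefl G refl u~u }) (∈-allFin u)))

  -- Transfers bounds between the natural-number exponent and the integer minimum.
  +∣fy∣ : ∀ S S≢∅ → + ℤ.∣ fy G S S≢∅ ∣ ≡ fy G S S≢∅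
  +∣fy∣ S S≢∅ = ℤ.0≤i⇒+∣i∣≡i (0≤fy G S S≢∅)

  ∣fy∣<2n : ∀ S S≢∅ → ℤ.∣ fy G S S≢∅ ∣ ℕ.< n + n
  ∣fy∣<2n S S≢∅@(u , _) = ℤ.drop‿+<+ (begin-strict
    + ℤ.∣ fy G S S≢∅ ∣    ≡⟨ +∣fy∣ S S≢∅ ⟩
    -- One member of `S` suffices for an upper bound: the default value of the minimum is the value
    -- at the given `u`.
    fy G S S≢∅            ≤⟨ min≤⊤ _ (map (λ v → excess G S v ℤ.+ + n)
                                   (filter (_∈? S) (allFin n))) ⟩
    excess G S u ℤ.+ + n  ≤⟨ ℤ.+-monoˡ-≤ (+ n) (ℤ.i-j≤i (+ δ G S u) (+ δ G (∁ S) u)) ⟩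
    + δ G S u ℤ.+ + n     <⟨ ℤ.+-monoˡ-< (+ n) (+<+ (δ<n S u)) ⟩
    + n ℤ.+ + n           ∎)
    where open ℤ.≤-Reasoning

  0≤excess⇒n≤excess+n : ∀ S u → 0ℤ ℤ.≤ excess G S u → + n ℤ.≤ excess G S u ℤ.+ + n
  0≤excess⇒n≤excess+n S u 0≤e =
    subst (ℤ._≤ excess G S u ℤ.+ + n) (ℤ.+-identityˡ (+ n))
      (ℤ.+-monoˡ-≤ (+ n) 0≤e)

  n≤excess+n⇒0≤excess : ∀ S u → + n ℤ.≤ excess G S u ℤ.+ + n → 0ℤ ℤ.≤ excess G S u
  n≤excess+n⇒0≤excess S u n≤e+n = ℤ.≮⇒≥ (λ e<0 → ℤ.<⇒≱
    (subst (excess G S u ℤ.+ + n ℤ.<_) (ℤ.+-identityˡ (+ n)) (ℤ.+-monoˡ-< (+ n) e<0)) n≤e+n)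

  strong⇒n≤∣fy∣ : ∀ {S} → StrongDefensiveAlliance G S → ∀ S≢∅ → n ℕ.≤ ℤ.∣ fy G S S≢∅ ∣
  strong⇒n≤∣fy∣ {S} (_ , 0≤excess) S≢∅@(u₀ , u₀∈S) =
    ℤ.drop‿+≤+ (subst (+ n ℤ.≤_) (sym (+∣fy∣ S S≢∅))
      -- The default value needs its own bound; it is taken at `u₀`, a member of `S`, so the
      -- alliance condition covers it too.
      (v≤min⁺ (0≤excess⇒n≤excess+n S u₀ (0≤excess u₀∈S))
        (All.map⁺ (All.map (λ {u} u∈S → 0≤excess⇒n≤excess+n S u (0≤excess u∈S))
          (All.all-filter (_∈? S) (allFin n))))))

  n≤∣fy∣⇒strong : ∀ {S} S≢∅ → n ℕ.≤ ℤ.∣ fy G S S≢∅ ∣ → StrongDefensiveAlliance G S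
  n≤∣fy∣⇒strong {S} S≢∅ n≤∣fy∣ = S≢∅ , λ {u} u∈S →
    n≤excess+n⇒0≤excess S u (begin
      + n                   ≤⟨ +≤+ n≤∣fy∣ ⟩
      + ℤ.∣ fy G S S≢∅ ∣    ≡⟨ +∣fy∣ S S≢∅ ⟩
      -- Each `u` in `S` survives the filter, so its value is among those minimised over.
      fy G S S≢∅            ≤⟨ All.lookup (All.map⁻ (min≤xs _ _))
                                 (∈-filter⁺ (_∈? S) (∈-allFin u) u∈S) ⟩
      excess G S u ℤ.+ + n  ∎)
    where open ℤ.≤-Reasoning

  Counted : Subset n → Set
  Counted S = Nonempty S × Connected (G [ S ]) × StrongDefensiveAlliance G S

  -- The decision `S?` is arbitrary, so matching on it reduces `daTerm` without unfolding the
  -- connectivity test.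
  window-daTerm-counted : ∀ {S} → Counted S → ∀ S? → window n (daTerm G S S?) ≡ x^ ∣ S ∣
  window-daTerm-counted {S} (_ , _ , strong) (yes (S≢∅ , _)) =
    window-inside n ∣ S ∣ (strong⇒n≤∣fy∣ strong S≢∅) (∣fy∣<2n S S≢∅)
  window-daTerm-counted (S≢∅ , conn , _) (no ¬p) = contradiction (S≢∅ , conn) ¬p

  window-daTerm-uncounted : ∀ {S} → ¬ Counted S → ∀ S? → window n (daTerm G S S?) ≡ []
  window-daTerm-uncounted {S} ¬counted (yes (S≢∅ , conn)) =
    -- A non-empty connected `S` can fail to be counted only by not being strong, which forces its
    -- exponent below `n`.
    window-below n ∣ S ∣ (ℕ.≰⇒> (λ n≤∣fy∣ →
      ¬counted (S≢∅ , conn , n≤∣fy∣⇒strong S≢∅ n≤∣fy∣)))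
  window-daTerm-uncounted ¬counted (no _) = window-zero n

  -- Subsets are compared one by one; then the sums over subsets and over `k` are exchanged, and
  -- additivity of `[y^_]_` reassembles `da G`.
  a≡window-da : a G ≡ window n (da G)
  a≡window-da = begin
    a G
      ≡⟨ sumOver-filter ℤ[x].rawMonoid ℤ[x]-isCommutativeMonoid _
           (λ counted → sym (window-daTerm-counted counted (summed? _)))
           (λ ¬counted → window-daTerm-uncounted ¬counted (summed? _)) (subsets n) ⟩
    sumOver ℤ[x].rawMonoid (subsets n) (λ S → window n (term S))
      ≡⟨ sumOver-swap ℤ[x].rawMonoid ℤ[x]-isCommutativeMonoid
           (subsets n) (upTo n) (λ S k → [y^ (n + k) ] term S) ⟩
    sumOver ℤ[x].rawMonoid (upTo n)
      (λ k → sumOver ℤ[x].rawMonoid (subsets n) (λ S → [y^ (n + k) ] term S))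
      ≡⟨ sumOver-cong ℤ[x].rawMonoid ℤ[x]-isCommutativeMonoid (upTo n)
           (λ k → [y^]-sumOver (n + k) (subsets n) term) ⟨
    window n (da G) ∎
    where
    open ≡-Reasoning
    summed? : ∀ S → Dec (Nonempty S × Connected (G [ S ]))
    summed? S = nonempty? S ×-dec connected? G S
    term : Subset n → ℤ[x][y].Poly
    term S = daTerm G S (summed? S)

proposition5 : (n : ℕ) .{{_ : NonZero n}} (G : Graph (Fin n)) →
    a G ≈ sumOver ℤ[x].rawMonoid (upTo n) (λ k → [y^ (n + k) ] da G)
proposition5 n G i = cong (λ p → ℤ[x].coeff p i) (a≡window-da G)
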